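{- Let $G$ be an oriented graph and $a,b$ positive integers. If $G$ admits a homomorphism to some consistent sub-orientation of the Kneser graph $KG_{a,b}$, then for every positive integer $c$ there exists a consistent sub-orientation $\overrightarrow{KG}_{ac,bc}$ of $KG_{ac,bc}$ such that $G$ admits a homomorphism to $\overrightarrow{KG}_{ac,bc}$.
   Context: An oriented graph is a finite directed graph with no directed cycle of length 1 or 2. A homomorphism of an oriented graph $G$ to an oriented graph $H$ is a map $f:V(G)\to V(H)$ such that $f(x)f(y)$ is an arc of $H$ whenever $xy$ is an arc of $G$. The Kneser graph $KG_{a,b}$ has the $b$-subsets of an $a$-set as vertices, two being adjacent iff they are disjoint. A consistent sub-orientation of $KG_{a,b}$ is an oriented graph whose underlying graph is a subgraph of $KG_{a,b}$ and such that for any two arcs $xy$ and $wz$, $x\cap z\neq\emptyset$ implies $y\cap w=\emptyset$. -}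

module Defs where

open import Data.Bool.Base using (Bool; T)
open import Data.Fin.Base using (Fin)
open import Data.Fin.Subset using (Subset; ∣_∣; _∩_; Empty; Nonempty)
open import Data.Nat.Base using (ℕ)
open import Data.Product.Base using (∃; proj₁; Σ-syntax)
open import Function.Base using (_∘_; _on_)
open import Function.Bundles using (_↔_)
open import Level using (0ℓ)
open import Relation.Binary.Construct.Closure.Symmetric using (SymClosure)
open import Relation.Binary.Core using (Rel; _⇒_; _=[_]⇒_)
open import Relation.Binary.Definitions using (Decidable; Irreflexive; Asymmetric)
open import Relation.Binary.PropositionalEquality.Core using (_≡_)

record Digraph : Set₁ where
  field
    V   : Set
    Arc : Rel V 0ℓ

Homomorphism : Digraph → Digraph → Set
Homomorphism G H = Σ[ f ∈ (V G → V H) ] (Arc G =[ f ]⇒ Arc H)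
  where open Digraph

-- Constructively, finiteness of the arc set amounts to decidability of Arc.
record IsOriented (G : Digraph) : Set where
  open Digraph G
  field
    finite     : ∃ λ n → V ↔ Fin n
    arc?       : Decidable Arc
    no-1-cycle : Irreflexive _≡_ Arc
    no-2-cycle : Asymmetric Arc

record OrientedGraph : Set₁ where
  field
    digraph    : Digraph
    isOriented : IsOriented digraph

  open Digraph digraph public
  open IsOriented isOriented public

KneserVertex : ℕ → ℕ → Set
KneserVertex a b = Σ[ s ∈ Subset a ] ∣ s ∣ ≡ b

KneserAdjacent : ∀ {a b} → Rel (KneserVertex a b) 0ℓ
KneserAdjacent x y = Empty (proj₁ x ∩ proj₁ y)

-- A subgraph may omit vertices of the Kneser graph. The vertex set is
-- Bool-valued so that a b-subset occurs at most once as a vertex.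
record KneserSubOrientation (a b : ℕ) : Set₁ where
  field
    isVertex : KneserVertex a b → Bool

  Vertex : Set
  Vertex = Σ[ x ∈ KneserVertex a b ] T (isVertex x)

  field
    Arc : Rel Vertex 0ℓ

  digraph : Digraph
  digraph = record { V = Vertex ; Arc = Arc }

  field
    isOriented : IsOriented digraph
    subgraph   : SymClosure Arc ⇒ (KneserAdjacent on proj₁)

  toSubset : Vertex → Subset a
  toSubset = proj₁ ∘ proj₁

Consistent : ∀ {a b} → KneserSubOrientation a b → Set
Consistent H = ∀ {x y w z} → Arc x y → Arc w z →
  Nonempty (toSubset x ∩ toSubset z) → Empty (toSubset y ∩ toSubset w)
  where open KneserSubOrientation H

{-# OPTIONS --safe #-}

-- Replace each of the a points by c copies of itself. This injects the b-subsets
-- of an a-set into the (bc)-subsets of an (ac)-set and both preserves and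
-- reflects disjointness, so the image of a consistent sub-orientation
-- is again one, isomorphic to the original.

module Submission where

open import Defs
open import Data.Bool.Base using (Bool; T)
open import Data.Bool.Properties using (T-irrelevant; _≟_)
open import Data.Fin.Base using (Fin; zero; combine)
open import Data.Fin.Properties using (any?; combine-surjective)
open import Data.Fin.Subset using (Subset; inside; outside; ∣_∣; _∩_; _∈_; _⊆_; Nonempty)
open import Data.Fin.Subset.Properties using (∣⊥∣≡0; ∣⊤∣≡n; ⊆-antisym; x∈p∩q⁺; x∈p∩q⁻)
open import Data.Nat.Base using (ℕ; suc; _+_; _*_; NonZero)
import Data.Nat.Properties as ℕ
open import Data.Product.Base using (_×_; _,_; proj₁; proj₂; Σ-syntax)
open import Data.Vec.Base using ([]; _∷_; _++_; concat; map; replicate; lookup)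
open import Data.Vec.Properties
  using (lookup⇒[]=; []=⇒lookup; lookup-concat; lookup-map; lookup-replicate; ≡-dec)
open import Function.Base using (_∘_; _on_; id)
open import Function.Bundles using (_↔_; mk↔ₛ′; Inverse)
open import Function.Construct.Composition using (_↔-∘_)
open import Function.Definitions using (Injective)
open import Relation.Binary.Construct.Closure.Symmetric using (gmap)
open import Relation.Binary.PropositionalEquality
  using (_≡_; refl; sym; trans; cong; cong₂; subst; subst₂; module ≡-Reasoning)
open import Relation.Nullary.Decidable using (Dec; toWitness; fromWitness; ⌊_⌋)

private
  variable
    a b c m n : ℕ

∣p++q∣≡∣p∣+∣q∣ : (p : Subset m) (q : Subset n) → ∣ p ++ q ∣ ≡ ∣ p ∣ + ∣ q ∣
∣p++q∣≡∣p∣+∣q∣ []            q = refl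
∣p++q∣≡∣p∣+∣q∣ (inside  ∷ p) q = cong suc (∣p++q∣≡∣p∣+∣q∣ p q)
∣p++q∣≡∣p∣+∣q∣ (outside ∷ p) q = ∣p++q∣≡∣p∣+∣q∣ p q

-- Copy `j` of point `i` sits at `combine i j`, so this is the preimage of `p` under the projection
-- sending each copy to its point.
blowup : ∀ c → Subset a → Subset (a * c)
blowup c p = concat (map (replicate c) p)

∣blowup∣ : ∀ c (p : Subset a) → ∣ blowup c p ∣ ≡ ∣ p ∣ * c
∣blowup∣ c []            = refl
∣blowup∣ c (inside  ∷ p) =
  trans (∣p++q∣≡∣p∣+∣q∣ (replicate c inside) (blowup c p)) (cong₂ _+_ (∣⊤∣≡n c) (∣blowup∣ c p))
∣blowup∣ c (outside ∷ p) =
  trans (∣p++q∣≡∣p∣+∣q∣ (replicate c outside) (blowup c p)) (cong₂ _+_ (∣⊥∣≡0 c) (∣blowup∣ c p))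

lookup-blowup : ∀ (p : Subset a) i (j : Fin c) → lookup (blowup c p) (combine i j) ≡ lookup p i
lookup-blowup {c = c} p i j = begin
  lookup (blowup c p) (combine i j)         ≡⟨ lookup-concat (map (replicate c) p) i j ⟩
  lookup (lookup (map (replicate c) p) i) j ≡⟨ cong (λ r → lookup r j) (lookup-map i (replicate c) p) ⟩
  lookup (replicate c (lookup p i)) j       ≡⟨ lookup-replicate j (lookup p i) ⟩
  lookup p i                                ∎
  where open ≡-Reasoning

∈-blowup⁺ : ∀ {p : Subset a} {i} (j : Fin c) → i ∈ p → combine i j ∈ blowup c p
∈-blowup⁺ {p = p} {i} j i∈p = lookup⇒[]= _ _ (trans (lookup-blowup p i j) ([]=⇒lookup i∈p))

∈-blowup⁻ : ∀ {p : Subset a} {i} (j : Fin c) → combine i j ∈ blowup c p → i ∈ p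
∈-blowup⁻ {p = p} {i} j ij∈ = lookup⇒[]= _ _ (trans (sym (lookup-blowup p i j)) ([]=⇒lookup ij∈))

-- Each point is tested through its copy `zero`, which exists because `c` is positive; for `c` equal
-- to 0 all blowups would be empty.
blowup-cancel-⊆ : ∀ c .{{_ : NonZero c}} {p q : Subset a} → blowup c p ⊆ blowup c q → p ⊆ q
blowup-cancel-⊆ (suc _) bp⊆bq i∈p = ∈-blowup⁻ zero (bp⊆bq (∈-blowup⁺ zero i∈p))

blowup-injective : ∀ c .{{_ : NonZero c}} → Injective _≡_ _≡_ (blowup {a} c)
blowup-injective c eq = ⊆-antisym
  (blowup-cancel-⊆ c (λ {x} → subst (x ∈_) eq))
  (blowup-cancel-⊆ c (λ {x} → subst (x ∈_) (sym eq)))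

-- Every point of the large set is a copy of some `i`, and whether it lies in a blowup depends on
-- `i` alone.
blowup-meet : ∀ c {p q : Subset a} → Nonempty (blowup c p ∩ blowup c q) → Nonempty (p ∩ q)
blowup-meet {a} c {p} {q} (x , x∈) with combine-surjective {a} {c} x
... | i , j , refl with ij∈bp , ij∈bq ← x∈p∩q⁻ (blowup c p) (blowup c q) x∈ =
  i , x∈p∩q⁺ (∈-blowup⁻ j ij∈bp , ∈-blowup⁻ j ij∈bq)

-- The size proof and the `T` proof are both unique, so a vertex is determined by its subset.
vertex-≡ : {P : KneserVertex a b → Bool} {x y : Σ[ s ∈ KneserVertex a b ] T (P s)} →
           proj₁ (proj₁ x) ≡ proj₁ (proj₁ y) → x ≡ y
vertex-≡ {x = (s , p) , v} {y = (.s , q) , w} refl with refl ← ℕ.≡-irrelevant p q =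
  cong (_ ,_) (T-irrelevant v w)

module Blowup (H : KneserSubOrientation a b) (c : ℕ) .{{_ : NonZero c}} where
  open KneserSubOrientation H
  open IsOriented isOriented

  private
    size = proj₁ finite
    open module V↔ = Inverse (proj₂ finite) using () renaming (to to index; from to vertex)

  -- Ranging over `Fin size` instead of `Vertex` lets a finite search decide this, as the Boolean
  -- `isVertex` requires.
  IsBlownUp : KneserVertex (a * c) (b * c) → Set
  IsBlownUp (t , _) = Σ[ i ∈ Fin size ] blowup c (toSubset (vertex i)) ≡ t

  isBlownUp? : ∀ t → Dec (IsBlownUp t)
  isBlownUp? (t , _) = any? λ i → ≡-dec _≟_ (blowup c (toSubset (vertex i))) t

  BlownUpVertex : Set
  BlownUpVertex = Σ[ t ∈ KneserVertex (a * c) (b * c) ] T ⌊ isBlownUp? t ⌋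

  shrink : BlownUpVertex → Vertex
  shrink (t , w) = vertex (proj₁ (toWitness {a? = isBlownUp? t} w))

  blowup-shrink : ∀ x → blowup c (toSubset (shrink x)) ≡ proj₁ (proj₁ x)
  blowup-shrink (t , w) = proj₂ (toWitness {a? = isBlownUp? t} w)

  expand : Vertex → BlownUpVertex
  expand u@((s , ∣s∣≡b) , _) =
    t , fromWitness {a? = isBlownUp? t}
          (index u , cong (blowup c ∘ toSubset) (V↔.strictlyInverseʳ u))
    where
    t : KneserVertex (a * c) (b * c)
    t = blowup c s , trans (∣blowup∣ c s) (cong (_* c) ∣s∣≡b)

  -- `shrink` uses the index returned by the search, not the one supplied by `expand`; both vertices
  -- have the same blowup, so injectivity identifies them.
  shrink-expand : ∀ u → shrink (expand u) ≡ u
  shrink-expand u = vertex-≡ (blowup-injective c (blowup-shrink (expand u)))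

  -- Adjacency and consistency both reduce to `H` through this: `Empty` negates `Nonempty`, so
  -- disjointness moves the other way by contraposition.
  meet-shrink : ∀ x y → Nonempty (proj₁ (proj₁ x) ∩ proj₁ (proj₁ y)) →
                Nonempty (toSubset (shrink x) ∩ toSubset (shrink y))
  meet-shrink x y =
    blowup-meet c ∘ subst₂ (λ p q → Nonempty (p ∩ q)) (sym (blowup-shrink x)) (sym (blowup-shrink y))

  blownUp : KneserSubOrientation (a * c) (b * c)
  blownUp = record
    { isVertex   = λ t → ⌊ isBlownUp? t ⌋
    -- Pulling arcs back along `shrink` lets decidability and the absence of loops and 2-cycles be
    -- inherited from `H`.
    ; Arc        = Arc on shrink
    ; isOriented = record
      { finite     = size , proj₂ finite ↔-∘ shrink↔
      ; arc?       = λ x y → arc? (shrink x) (shrink y)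
      ; no-1-cycle = no-1-cycle ∘ cong shrink
      ; no-2-cycle = no-2-cycle
      }
    ; subgraph   = λ {x} {y} xy → subgraph (gmap shrink id xy) ∘ meet-shrink x y
    }
    where
    expand-shrink : ∀ x → expand (shrink x) ≡ x
    expand-shrink x = vertex-≡ (blowup-shrink x)

    shrink↔ : BlownUpVertex ↔ Vertex
    shrink↔ = mk↔ₛ′ shrink expand shrink-expand expand-shrink

  expand-arc : ∀ u v → Arc u v → Arc (shrink (expand u)) (shrink (expand v))
  expand-arc u v = subst₂ Arc (sym (shrink-expand u)) (sym (shrink-expand v))

theorem2 : (G : OrientedGraph) (a b : ℕ) .{{_ : NonZero a}} .{{_ : NonZero b}} →
    (Σ[ H ∈ KneserSubOrientation a b ]
    (Consistent H ×
    Homomorphism (OrientedGraph.digraph G) (KneserSubOrientation.digraph H))) →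
    (c : ℕ) .{{_ : NonZero c}} →
    Σ[ K ∈ KneserSubOrientation (a * c) (b * c) ]
    (Consistent K ×
    Homomorphism (OrientedGraph.digraph G) (KneserSubOrientation.digraph K))
theorem2 G a b (H , consistent , f , f-arc) c =
  blownUp ,
  -- `xy` and `wz` are by definition arcs of `H` between shrunk vertices, so only the two
  -- intersections have to be carried down to `H`.
  (λ {x} {y} {w} {z} xy wz x∩z y∩w → consistent xy wz (meet-shrink x z x∩z) (meet-shrink y w y∩w)) ,
  expand ∘ f , λ {u} {v} uv → expand-arc (f u) (f v) (f-arc uv)
  where open Blowup H c
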